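{- Let $k \geq 4$ be an even integer. Then $h(n,k) \leq \frac{n(3k+8)(k-2)}{4(3k-4)}$ for every positive integer $n$ with $n \equiv 0 \pmod{\frac{3k-4}{2}}$.
   Context: All graphs are finite and simple. A degree monotone path in a graph $G$ is a path $v_1v_2\ldots v_m$ such that $\deg(v_1)\le\cdots\le\deg(v_m)$ or $\deg(v_1)\ge\cdots\ge\deg(v_m)$, where degrees are taken in $G$. Its length is its number of vertices $m$. $mp(G)$ denotes the maximum length of a degree monotone path in $G$. For $k\ge 2$, a graph $G$ is called $k$-saturated if $mp(G)<k$ and $mp(G+e)\ge k$ for every edge $e$ joining two nonadjacent vertices of $G$, where $G+e$ is $G$ with $e$ added. In particular, every complete graph $K_m$ with $m\le k-1$ is $k$-saturated. $h(n,k)$ is the minimum number of edges of a $k$-saturated graph on $n$ vertices. -}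

module Defs where

open import Data.Bool using (Bool; true; false; _∧_; _∨_; if_then_else_)
open import Data.Nat using (ℕ; _≤_; _<_; _≥_; _<?_)
open import Data.Fin using (Fin; toℕ; _≟_)
open import Data.List using (List; length; map; allFin)
open import Data.Nat.ListAction using (sum)
open import Data.List.Relation.Unary.Linked using (Linked)
open import Data.List.Relation.Unary.Unique.Propositional using (Unique)
open import Data.Product using (_×_; Σ)
open import Data.Sum using (_⊎_)
open import Relation.Nullary using (¬_)
open import Relation.Nullary.Decidable using (⌊_⌋)
open import Relation.Binary.PropositionalEquality using (_≡_; _≢_)

Adj : ℕ → Set
Adj n = Fin n → Fin n → Bool

IsSimple : ∀ {n} → Adj n → Set
IsSimple {n} G = ((i j : Fin n) → G i j ≡ G j i) × ((i : Fin n) → G i i ≡ false)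

deg : ∀ {n} → Adj n → Fin n → ℕ
deg {n} G i = sum (map (λ j → if G i j then 1 else 0) (allFin n))

edgeCount : ∀ {n} → Adj n → ℕ
edgeCount {n} G =
  sum (map (λ i → sum (map (λ j → if G i j ∧ ⌊ toℕ i <? toℕ j ⌋ then 1 else 0) (allFin n))) (allFin n))

addEdge : ∀ {n} → Adj n → Fin n → Fin n → Adj n
addEdge G u v i j = G i j ∨ (⌊ i ≟ u ⌋ ∧ ⌊ j ≟ v ⌋) ∨ (⌊ i ≟ v ⌋ ∧ ⌊ j ≟ u ⌋)

IsPath : ∀ {n} → Adj n → List (Fin n) → Set
IsPath G vs = Unique vs × Linked (λ a b → G a b ≡ true) vs

IsDegMonotonePath : ∀ {n} → Adj n → List (Fin n) → Set
IsDegMonotonePath G vs =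
  IsPath G vs ×
  (Linked (λ a b → deg G a ≤ deg G b) vs ⊎ Linked (λ a b → deg G a ≥ deg G b) vs)

mpLt : ∀ {n} → Adj n → ℕ → Set
mpLt {n} G k = (vs : List (Fin n)) → IsDegMonotonePath G vs → length vs < k

mpGe : ∀ {n} → Adj n → ℕ → Set
mpGe {n} G k = Σ (List (Fin n)) λ vs → IsDegMonotonePath G vs × k ≤ length vs

IsSaturated : ∀ {n} → ℕ → Adj n → Set
IsSaturated {n} k G =
  IsSimple G × mpLt G k ×
  ((u v : Fin n) → u ≢ v → G u v ≡ false → mpGe (addEdge G u v) k)

{-# OPTIONS --safe #-}
module Submission where

-- A block consists of an apex, a clique of core vertices and two cliques of row vertices, all three
-- cliques of size k/2 - 1. The core vertices are joined to the apex and matched with both rows, and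
-- a row vertex has one more neighbour among the apexes. Rows then have degree k/2, core vertices and
-- all apexes but one have degree k/2 + 1, so a degree monotone path lives in one row and one core
-- (with its apex) and has at most k - 1 vertices. Disjoint blocks whose rows all see their own apex
-- would not be saturated: those apexes have such a large degree that an edge from a core vertex to the
-- apex of another block creates no long path. Hence a single apex, the hub, takes over the row
-- neighbours of the other apexes, which keep just enough of them to have the degree of a core vertex.
-- Every path demanded by saturation uses up a row and a core before or after crossing the new edge.

open import Defs
open import Data.Nat using (ℕ; _≤_; _*_; _+_; _∸_)
open import Data.Nat.Divisibility using (_∣_; divides)
open import Data.Nat.DivMod using (_/_; m*n/n≡m)
open import Data.Product using (Σ; _×_)

open import Data.Bool using (Bool; true; false; _∧_; _∨_; not; if_then_else_)
import Data.Bool.Properties as Bool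
open import Data.Empty using (⊥)
open import Data.Fin using (Fin; zero; suc; toℕ; _≟_; _↑ˡ_; _↑ʳ_; combine; remQuot; splitAt; join; punchIn; punchOut)
import Data.Fin.Properties as Fin
open import Data.List using (List; []; _∷_; _++_; _∷ʳ_; length; map; tabulate; allFin; lookup)
open import Data.List.Membership.Propositional.Properties using (∈-lookup)
import Data.List.Properties as List
open import Data.List.Relation.Unary.All as All using (All; []; _∷_)
import Data.List.Relation.Unary.All.Properties as All
open import Data.List.Relation.Unary.AllPairs using ([]; _∷_)
import Data.List.Relation.Unary.AllPairs.Properties as AllPairs
open import Data.List.Relation.Unary.Linked as Linked using (Linked; []; [-]; _∷_)
import Data.List.Relation.Unary.Linked.Properties as Linked
open import Data.List.Relation.Unary.Unique.Propositional using (Unique)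
import Data.List.Relation.Unary.Unique.Propositional.Properties as Unique
open import Data.Nat using (zero; suc; _<_; _≥_; _<?_; z≤n; s≤s)
import Data.Nat.ListAction as ListAction
import Data.Nat.Properties as ℕ
open import Data.Nat.Tactic.RingSolver using (solve-∀)
open import Data.Product using (∃; ∃₂; _,_; proj₁; proj₂; uncurry)
open import Data.Sum using (_⊎_; inj₁; inj₂; [_,_]′)
open import Data.Vec.Functional using (replicate)
open import Function using (_∘_; _⟨_⟩_)
open import Relation.Binary.PropositionalEquality
open import Relation.Nullary using (¬_; Dec; yes; no; contradiction)
open import Relation.Nullary.Decidable using (⌊_⌋; isYes≗does; dec-true; dec-false)

open import Algebra.Properties.CommutativeMonoid.Sum ℕ.+-0-commutativeMonoid
  using (sum-syntax; sum-cong-≗; sum-remove; sum-replicate-zero; ∑-distrib-+; ∑-comm)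
  renaming (sum to ∑)

-- Indicators and finite sums

⟦_⟧ : Bool → ℕ
⟦ b ⟧ = if b then 1 else 0

⌊⌋-true : ∀ {a} {A : Set a} (d : Dec A) → A → ⌊ d ⌋ ≡ true
⌊⌋-true d a = trans (isYes≗does d) (dec-true d a)

⌊⌋-false : ∀ {a} {A : Set a} (d : Dec A) → ¬ A → ⌊ d ⌋ ≡ false
⌊⌋-false d ¬a = trans (isYes≗does d) (dec-false d ¬a)

≟-sym : ∀ {n} (i j : Fin n) → ⌊ i ≟ j ⌋ ≡ ⌊ j ≟ i ⌋
≟-sym i j with i ≟ j
... | yes i≡j = sym (⌊⌋-true (j ≟ i) (sym i≡j))
... | no i≢j = sym (⌊⌋-false (j ≟ i) (i≢j ∘ sym))

∑-const : ∀ n c → ∑[ i < n ] c ≡ n * c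
∑-const zero c = refl
∑-const (suc n) c = cong (c +_) (∑-const n c)

∑-pick : ∀ {n} (i : Fin n) (f : Fin n → ℕ) → (∀ j → i ≢ j → f j ≡ 0) → ∑ f ≡ f i
∑-pick {suc n} i f f≡0 = begin
  ∑ f                                  ≡⟨ sum-remove {i = i} f ⟩
  f i + ∑[ j < n ] f (punchIn i j)     ≡⟨ cong (f i +_) (sum-cong-≗ λ j → f≡0 _ (Fin.punchInᵢ≢i i j ∘ sym)) ⟩
  f i + ∑ (replicate n 0)              ≡⟨ cong (f i +_) (sum-replicate-zero n) ⟩
  f i + 0                              ≡⟨ ℕ.+-identityʳ _ ⟩
  f i                                  ∎
  where open ≡-Reasoning

term≤∑ : ∀ {n} (f : Fin n → ℕ) i → f i ≤ ∑ f
term≤∑ {suc n} f i = subst (f i ≤_) (sym (sum-remove {i = i} f)) (ℕ.m≤m+n (f i) _)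

∑-mono : ∀ {n} {f g : Fin n → ℕ} → (∀ i → f i ≤ g i) → ∑ f ≤ ∑ g
∑-mono {zero} f≤g = z≤n
∑-mono {suc n} f≤g = ℕ.+-mono-≤ (f≤g zero) (∑-mono (f≤g ∘ suc))

∑-≟ : ∀ {n} (i : Fin n) → ∑[ j < n ] ⟦ ⌊ i ≟ j ⌋ ⟧ ≡ 1
∑-≟ i = trans (∑-pick i _ λ j i≢j → cong ⟦_⟧ (⌊⌋-false (i ≟ j) i≢j)) (cong ⟦_⟧ (⌊⌋-true (i ≟ i) refl))

∑-≢ : ∀ {n} (i : Fin (suc n)) → ∑[ j < suc n ] ⟦ not ⌊ i ≟ j ⌋ ⟧ ≡ n
∑-≢ {n} i = begin
  ∑ f                                            ≡⟨ sum-remove {i = i} f ⟩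
  f i + ∑[ j < n ] f (punchIn i j)               ≡⟨ cong₂ _+_ (cong (⟦_⟧ ∘ not) (⌊⌋-true (i ≟ i) refl))
                                                      (sum-cong-≗ λ j → cong (⟦_⟧ ∘ not) (⌊⌋-false (i ≟ _) (Fin.punchInᵢ≢i i j ∘ sym))) ⟩
  ∑[ j < n ] 1                                   ≡⟨ ∑-const n 1 ⟩
  n * 1                                          ≡⟨ ℕ.*-identityʳ n ⟩
  n                                              ∎
  where
  open ≡-Reasoning
  f : Fin (suc n) → ℕ
  f j = ⟦ not ⌊ i ≟ j ⌋ ⟧

∑-+ : ∀ m {n} (f : Fin (m + n) → ℕ) → ∑ f ≡ ∑[ i < m ] f (i ↑ˡ n) + ∑[ j < n ] f (m ↑ʳ j)
∑-+ zero f = refl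
∑-+ (suc m) f = trans (cong (f zero +_) (∑-+ m (f ∘ suc))) (sym (ℕ.+-assoc (f zero) _ _))

∑-* : ∀ m {n} (f : Fin (m * n) → ℕ) → ∑ f ≡ ∑[ i < m ] ∑[ j < n ] f (combine i j)
∑-* zero f = refl
∑-* (suc m) {n} f = trans (∑-+ n f) (cong (∑[ j < n ] f (j ↑ˡ (m * n)) +_) (∑-* m _))

sum-allFin : ∀ n (f : Fin n → ℕ) → ListAction.sum (map f (allFin n)) ≡ ∑ f
sum-allFin n f = trans (cong ListAction.sum (List.map-tabulate (λ i → i) f)) (go n f)
  where
  go : ∀ n (f : Fin n → ℕ) → ListAction.sum (tabulate f) ≡ ∑ f
  go zero f = refl
  go (suc n) f = cong (f zero +_) (go n (f ∘ suc))

-- Degrees in a graph and in its one-edge extensions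

deg-∑ : ∀ {n} (G : Adj n) x → deg G x ≡ ∑[ y < n ] ⟦ G x y ⟧
deg-∑ {n} G x = sum-allFin n _

deg-cong : ∀ {n} {G H : Adj n} → (∀ x y → G x y ≡ H x y) → ∀ x → deg G x ≡ deg H x
deg-cong {G = G} {H} G≗H x =
  trans (deg-∑ G x) (trans (sum-cong-≗ λ y → cong ⟦_⟧ (G≗H x y)) (sym (deg-∑ H x)))

-- `edgeCount` counts each edge at its smaller end. Exchanging the summations in a second copy
-- counts it at its larger end, so together the copies count ordered adjacent pairs; irreflexivity
-- rules out the diagonal.
handshake : ∀ {n} (G : Adj n) → IsSimple G → 2 * edgeCount G ≡ ∑[ x < n ] deg G x
handshake {n} G (G-sym , G-irr) = begin
  2 * edgeCount G                                            ≡⟨ cong (2 *_) (trans (sum-allFin n _) (sum-cong-≗ λ x → sum-allFin n (up x))) ⟩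
  2 * ∑[ x < n ] ∑[ y < n ] up x y                           ≡⟨ cong (∑[ x < n ] ∑[ y < n ] up x y +_) (ℕ.+-identityʳ _) ⟩
  ∑[ x < n ] ∑[ y < n ] up x y + ∑[ x < n ] ∑[ y < n ] up x y
                                                             ≡⟨ cong (∑[ x < n ] ∑[ y < n ] up x y +_) (∑-comm up) ⟩
  ∑[ x < n ] ∑[ y < n ] up x y + ∑[ x < n ] ∑[ y < n ] up y x
                                                             ≡⟨ ∑-distrib-+ (λ x → ∑[ y < n ] up x y) _ ⟨
  ∑[ x < n ] (∑[ y < n ] up x y + ∑[ y < n ] up y x)         ≡⟨ (sum-cong-≗ λ x → sym (∑-distrib-+ (up x) _)) ⟩
  ∑[ x < n ] ∑[ y < n ] (up x y + up y x)                    ≡⟨ (sum-cong-≗ λ x → sum-cong-≗ λ y → split x y) ⟩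
  ∑[ x < n ] ∑[ y < n ] ⟦ G x y ⟧                            ≡⟨ (sum-cong-≗ λ x → sym (deg-∑ G x)) ⟩
  ∑[ x < n ] deg G x                                         ∎
  where
  open ≡-Reasoning
  up : Fin n → Fin n → ℕ
  up x y = ⟦ G x y ∧ ⌊ toℕ x <? toℕ y ⌋ ⟧
  split : ∀ x y → up x y + up y x ≡ ⟦ G x y ⟧
  split x y rewrite G-sym y x with G x y in Gxy
  ... | false = refl
  ... | true with toℕ x <? toℕ y | toℕ y <? toℕ x
  ...   | yes x<y | yes y<x = contradiction y<x (ℕ.<-asym x<y)
  ...   | yes _   | no _    = refl
  ...   | no _    | yes _   = refl
  ...   | no x≮y  | no y≮x  =
    contradiction (trans (sym Gxy) (trans (cong (G x) (sym x≡y)) (G-irr x))) λ ()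
    where
    x≡y : x ≡ y
    x≡y = Fin.toℕ-injective (ℕ.≤-antisym (ℕ.≮⇒≥ y≮x) (ℕ.≮⇒≥ x≮y))

addEdge-keeps : ∀ {n} (G : Adj n) u v {x y} → G x y ≡ true → addEdge G u v x y ≡ true
addEdge-keeps G u v Gxy rewrite Gxy = refl

addEdge-new : ∀ {n} (G : Adj n) u v → addEdge G u v u v ≡ true
addEdge-new G u v rewrite ⌊⌋-true (u ≟ u) refl | ⌊⌋-true (v ≟ v) refl = Bool.∨-zeroʳ (G u v)

addEdge-comm : ∀ {n} (G : Adj n) u v x y → addEdge G u v x y ≡ addEdge G v u x y
addEdge-comm G u v x y = cong (G x y ∨_) (Bool.∨-comm (⌊ x ≟ u ⌋ ∧ ⌊ y ≟ v ⌋) _)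

deg≤deg-addEdge : ∀ {n} (G : Adj n) u v x → deg G x ≤ deg (addEdge G u v) x
deg≤deg-addEdge G u v x = subst₂ _≤_ (sym (deg-∑ G x)) (sym (deg-∑ (addEdge G u v) x)) (∑-mono λ y → ≤∨ (G x y))
  where
  ≤∨ : ∀ b {c} → ⟦ b ⟧ ≤ ⟦ b ∨ c ⟧
  ≤∨ false = z≤n
  ≤∨ true = ℕ.≤-refl

deg-addEdge-other : ∀ {n} (G : Adj n) u v {x} → x ≢ u → x ≢ v → deg (addEdge G u v) x ≡ deg G x
deg-addEdge-other G u v {x} x≢u x≢v =
  trans (deg-∑ (addEdge G u v) x) (trans (sum-cong-≗ λ y → cong ⟦_⟧ (same y)) (sym (deg-∑ G x)))
  where
  same : ∀ y → addEdge G u v x y ≡ G x y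
  same y rewrite ⌊⌋-false (x ≟ u) x≢u | ⌊⌋-false (x ≟ v) x≢v = Bool.∨-identityʳ (G x y)

deg-addEdge-end : ∀ {n} (G : Adj n) {u v} → u ≢ v → G u v ≡ false → deg (addEdge G u v) u ≡ suc (deg G u)
deg-addEdge-end {n} G {u} {v} u≢v Guv = begin
  deg (addEdge G u v) u                               ≡⟨ deg-∑ (addEdge G u v) u ⟩
  ∑[ y < n ] ⟦ addEdge G u v u y ⟧                    ≡⟨ sum-cong-≗ split ⟩
  ∑[ y < n ] (⟦ ⌊ v ≟ y ⌋ ⟧ + ⟦ G u y ⟧)              ≡⟨ ∑-distrib-+ (λ y → ⟦ ⌊ v ≟ y ⌋ ⟧) _ ⟩
  ∑[ y < n ] ⟦ ⌊ v ≟ y ⌋ ⟧ + ∑[ y < n ] ⟦ G u y ⟧     ≡⟨ cong₂ _+_ (∑-≟ v) (sym (deg-∑ G u)) ⟩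
  suc (deg G u)                                       ∎
  where
  open ≡-Reasoning
  split : ∀ y → ⟦ addEdge G u v u y ⟧ ≡ ⟦ ⌊ v ≟ y ⌋ ⟧ + ⟦ G u y ⟧
  split y rewrite ⌊⌋-true (u ≟ u) refl | ⌊⌋-false (u ≟ v) u≢v | ≟-sym y v with v ≟ y
  -- Nonadjacency enters here: the new neighbour was not counted before.
  ... | yes refl rewrite Guv = refl
  ... | no _ = cong ⟦_⟧ (Bool.∨-identityʳ (G u y))

-- Serves to swap the ends of an added edge, which changes the adjacency function only up to
-- pointwise equality.
mpGe-cong : ∀ {n k} {G H : Adj n} → (∀ x y → G x y ≡ H x y) → mpGe G k → mpGe H k
mpGe-cong {G = G} {H} G≗H (vs , ((uniq , adj) , mono) , k≤) =
  vs , ((uniq , Linked.map (λ {x} {y} → trans (sym (G≗H x y))) adj) ,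
        [ inj₁ ∘ Linked.map (λ {x} {y} → subst₂ _≤_ (eq x) (eq y))
        , inj₂ ∘ Linked.map (λ {x} {y} → subst₂ _≤_ (eq y) (eq x)) ]′ mono) , k≤
  where
  eq : ∀ x → deg G x ≡ deg H x
  eq = deg-cong G≗H

-- Chains with prescribed ends

-- Unlike `Linked`, the type shows both ends, so that walks through different cliques can be glued
-- along an edge between known vertices.
data Chain {A : Set} (R : A → A → Set) : A → List A → A → Set where
  [-] : ∀ {x} → Chain R x (x ∷ []) x
  _∷_ : ∀ {x y xs z} → R x y → Chain R y xs z → Chain R x (x ∷ xs) z

infixr 5 _∷_

module _ {A : Set} {R : A → A → Set} where

  chain-++ : ∀ {x xs y z zs w} → Chain R x xs y → R y z → Chain R z zs w → Chain R x (xs ++ zs) w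
  chain-++ [-] r c = r ∷ c
  chain-++ (q ∷ b) r c = q ∷ chain-++ b r c

  chain⇒linked : ∀ {x xs y} → Chain R x xs y → Linked R xs
  chain⇒linked [-] = [-]
  chain⇒linked (r ∷ [-]) = r ∷ [-]
  chain⇒linked (r ∷ c@(_ ∷ _)) = r ∷ chain⇒linked c

  chain-head : ∀ {P : A → Set} {x xs y} → Chain R x xs y → All P xs → P x
  chain-head [-] (px ∷ _) = px
  chain-head (_ ∷ _) (px ∷ _) = px

  chain-map : ∀ {B : Set} {S : B → B → Set} (f : A → B) → (∀ {a b} → R a b → S (f a) (f b)) →
    ∀ {x xs y} → Chain R x xs y → Chain S (f x) (map f xs) (f y)
  chain-map f R⇒S [-] = [-]
  chain-map f R⇒S (r ∷ c) = R⇒S r ∷ chain-map f R⇒S c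

chain-from : ∀ {A : Set} {x : A} {xs} → Unique (x ∷ xs) → ∃ λ z → Chain _≢_ x (x ∷ xs) z
chain-from {x = x} {[]} _ = x , [-]
chain-from {xs = y ∷ ys} ((x≢y ∷ _) ∷ u) = proj₁ (chain-from u) , x≢y ∷ proj₂ (chain-from u)

-- The relation also records that no step starts at the final vertex. That vertex is often an end of
-- the added edge, and a step leaving such an end needs a separate degree comparison.
chain-to : ∀ {A : Set} {x : A} {xs} → Unique xs → All (_≢ x) xs →
  ∃ λ h → Chain (λ a b → a ≢ b × a ≢ x) h (xs ∷ʳ x) x × Unique (xs ∷ʳ x)
chain-to {x = x} {[]} [] [] = x , [-] , [] ∷ []
chain-to {xs = y ∷ ys} (y∉ys ∷ u) (y≢x ∷ ys≢x) with chain-to u ys≢x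
... | h , c , u′ = y , (chain-head c y∉ , y≢x) ∷ c , y∉ ∷ u′
  where
  y∉ : All (y ≢_) _
  y∉ = All.++⁺ y∉ys (y≢x ∷ [])

-- A Hamiltonian path of a clique with given start: every ordering of the vertices is a path, so `i`
-- followed by the values of `punchIn i` will do.
tour-from : ∀ {n} (i : Fin (suc n)) → ∃₂ λ xs z → Chain _≢_ i xs z × Unique xs × length xs ≡ suc n
tour-from i = _ , _ , proj₂ (chain-from u) , u , cong suc (List.length-tabulate (punchIn i))
  where
  u : Unique (i ∷ tabulate (punchIn i))
  u = All.tabulate⁺ (λ j → Fin.punchInᵢ≢i i j ∘ sym) ∷ Unique.tabulate⁺ (Fin.punchIn-injective i _ _)

tour-to : ∀ {n} (i : Fin (suc n)) →
  ∃₂ λ h xs → Chain (λ a b → a ≢ b × a ≢ i) h xs i × Unique xs × length xs ≡ suc n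
tour-to {n} i with chain-to {x = i} (Unique.tabulate⁺ (Fin.punchIn-injective i _ _)) (All.tabulate⁺ (Fin.punchInᵢ≢i i))
... | h , c , u = h , _ , c , u ,
  trans (List.length-++ (tabulate (punchIn i))) (trans (cong (_+ 1) (List.length-tabulate (punchIn i))) (ℕ.+-comm n 1))

-- A tour of a clique with one index fewer, relabelled by `punchIn j` so that `j` is skipped.
tour-avoiding : ∀ {n} (i j : Fin (suc n)) → j ≢ i →
  ∃₂ λ h xs → Chain (λ a b → a ≢ j × a ≢ b) h xs i × Unique xs × All (_≢ j) xs × length xs ≡ n
tour-avoiding {zero} zero zero j≢i = contradiction refl j≢i
tour-avoiding {suc n} i j j≢i with tour-to (punchOut j≢i)
... | h , xs , c , u , len = _ , map (punchIn j) xs ,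
  subst (Chain _ _ _) (Fin.punchIn-punchOut j≢i)
    (chain-map (punchIn j) (λ (a≢b , _) → Fin.punchInᵢ≢i j _ , a≢b ∘ Fin.punchIn-injective j _ _) c) ,
  Unique.map⁺ (Fin.punchIn-injective j _ _) u ,
  All.map⁺ (All.universal (Fin.punchInᵢ≢i j) xs) , trans (List.length-map (punchIn j) xs) len

all-map-++ : ∀ {A B : Set} {P : B → Set} {f : A → B} → (∀ a → P (f a)) → ∀ xs {ys} → All P ys → All P (map f xs ++ ys)
all-map-++ Pf xs = All.++⁺ (All.map⁺ (All.universal Pf xs))

unique-map-++ : ∀ {A B : Set} {f : A → B} → (∀ {a b} → f a ≡ f b → a ≡ b) → ∀ {xs ys} →
  Unique xs → All (λ y → ∀ a → f a ≢ y) ys → Unique ys → Unique (map f xs ++ ys)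
unique-map-++ inj {xs} u fresh v =
  AllPairs.++⁺ (Unique.map⁺ inj u) v (All.map⁺ (All.universal (λ a → All.map (λ f≢ → f≢ a) fresh) xs))

length-map-++ : ∀ {A B : Set} (f : A → B) xs ys {m} → length xs ≡ m → length (map f xs ++ ys) ≡ m + length ys
length-map-++ f xs ys refl = trans (List.length-++ (map f xs)) (cong (_+ length ys) (List.length-map f xs))

lookup-injective : ∀ {A : Set} {xs : List A} → Unique xs → ∀ {i j} → lookup xs i ≡ lookup xs j → i ≡ j
lookup-injective (_ ∷ _) {zero} {zero} _ = refl
lookup-injective {xs = _ ∷ xs} (x∉xs ∷ _) {zero} {suc j} eq = contradiction eq (All.lookup x∉xs (∈-lookup j))
lookup-injective {xs = _ ∷ xs} (x∉xs ∷ _) {suc i} {zero} eq = contradiction (sym eq) (All.lookup x∉xs (∈-lookup i))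
lookup-injective (_ ∷ u) {suc i} {suc j} eq = cong suc (lookup-injective u eq)

-- Label sequences that switch at most once

module _ {L : Set} {P Q : L → Set} (disjoint : ∀ {a} → P a → Q a → ⊥) where

  private
    Phase : L → L → Set
    Phase a b = a ≡ b ⊎ (P a × Q b)

  second-phase : ∀ {x xs} → Q x → Linked Phase (x ∷ xs) → All (_≡ x) (x ∷ xs)
  second-phase q [-] = refl ∷ []
  second-phase q (inj₁ refl ∷ l) = refl ∷ second-phase q l
  second-phase q (inj₂ (p , _) ∷ l) = contradiction q (disjoint p)

  first-phase : ∀ {x xs c} → P x → Q c → Linked Phase (x ∷ xs) →
    ∃ λ c → Q c × All (λ a → a ≡ x ⊎ a ≡ c) (x ∷ xs)
  first-phase {c = c} p q [-] = c , q , inj₁ refl ∷ []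
  first-phase p q (inj₁ refl ∷ l) with first-phase p q l
  ... | c , q′ , all = c , q′ , inj₁ refl ∷ all
  first-phase p q (inj₂ (_ , q′) ∷ l) = _ , q′ , inj₁ refl ∷ All.map inj₂ (second-phase q′ l)

  -- A change of label leads from `P` to `Q`, and disjointness forbids any change after that. The
  -- given `r` and `c` are fallbacks for a phase that never occurs.
  two-phases : ∀ {r c} → P r → Q c → (∀ a → P a ⊎ Q a) → ∀ {xs} → Linked Phase xs →
    ∃₂ λ r c → P r × Q c × All (λ a → a ≡ r ⊎ a ≡ c) xs
  two-phases {r} {c} p q split {[]} l = r , c , p , q , []
  two-phases {r} {c} p q split {x ∷ xs} l with split x
  ... | inj₁ px = x , proj₁ f , px , proj₂ f
    where f = first-phase px q l
  ... | inj₂ qx = r , x , p , qx , All.map inj₂ (second-phase qx l)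

-- The hub graph

-- There are t + 1 blocks, the cliques have size p + 1, and k = 2p + 4.
module Hub (t p : ℕ) where

  data Vertex : Set where
    row  : Fin (suc t) → Bool → Fin (suc p) → Vertex
    core : Fin (suc t) → Fin (suc p) → Vertex
    apex : Fin (suc t) → Vertex

  -- The block of the apex seen by the i-th vertex of a row of block s; apex zero is the hub.
  home : Fin (suc t) → Fin (suc p) → Fin (suc t)
  home s zero    = s
  home s (suc _) = zero

  -- Only the adjacency between rows and apexes, given by `home`, can cross between blocks, and then
  -- it leads to the hub.
  joined : Vertex → Vertex → Bool
  joined (row s σ i) (row s′ τ j) = ⌊ s ≟ s′ ⌋ ∧ ⌊ σ Bool.≟ τ ⌋ ∧ not ⌊ i ≟ j ⌋
  joined (row s σ i) (core s′ j)  = ⌊ s ≟ s′ ⌋ ∧ ⌊ i ≟ j ⌋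
  joined (row s σ i) (apex s′)    = ⌊ home s i ≟ s′ ⌋
  joined (core s i)  (row s′ τ j) = ⌊ s ≟ s′ ⌋ ∧ ⌊ i ≟ j ⌋
  joined (core s i)  (core s′ j)  = ⌊ s ≟ s′ ⌋ ∧ not ⌊ i ≟ j ⌋
  joined (core s i)  (apex s′)    = ⌊ s ≟ s′ ⌋
  joined (apex s)    (row s′ τ j) = ⌊ home s′ j ≟ s ⌋
  joined (apex s)    (core s′ j)  = ⌊ s ≟ s′ ⌋
  joined (apex s)    (apex s′)    = false

  -- With `k = 2p + 4` this is `(3k - 4) / 2`, the modulus of the theorem.
  size : ℕ
  size = suc (suc p + (suc p + suc p))

  -- Numbering the vertices

  slot : Fin (suc t) → Fin size → Vertex
  slot s zero    = apex s
  slot s (suc x) = [ core s , [ row s false , row s true ]′ ∘ splitAt (suc p) ]′ (splitAt (suc p) x)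

  decode : Fin (suc t * size) → Vertex
  decode x = uncurry slot (remQuot {suc t} size x)

  block : Vertex → Fin (suc t)
  block (row s _ _) = s
  block (core s _)  = s
  block (apex s)    = s

  place : Vertex → Fin size
  place (row s false i) = suc (suc p ↑ʳ (i ↑ˡ suc p))
  place (row s true i)  = suc (suc p ↑ʳ (suc p ↑ʳ i))
  place (core s i)      = suc (i ↑ˡ (suc p + suc p))
  place (apex s)        = zero

  encode : Vertex → Fin (suc t * size)
  encode v = combine (block v) (place v)

  slot-place : ∀ v → slot (block v) (place v) ≡ v
  slot-place (row s false i)
    rewrite Fin.splitAt-↑ʳ (suc p) (suc p + suc p) (i ↑ˡ suc p) | Fin.splitAt-↑ˡ (suc p) i (suc p) = refl
  slot-place (row s true i)
    rewrite Fin.splitAt-↑ʳ (suc p) (suc p + suc p) (suc p ↑ʳ i) | Fin.splitAt-↑ʳ (suc p) (suc p) i = refl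
  slot-place (core s i) rewrite Fin.splitAt-↑ˡ (suc p) i (suc p + suc p) = refl
  slot-place (apex s) = refl

  decode-combine : ∀ s x → decode (combine s x) ≡ slot s x
  decode-combine s x = cong (uncurry slot) (Fin.remQuot-combine {suc t} {size} s x)

  decode-encode : ∀ v → decode (encode v) ≡ v
  decode-encode v = trans (decode-combine (block v) (place v)) (slot-place v)

  encode-slot : ∀ s x → encode (slot s x) ≡ combine s x
  encode-slot s zero = refl
  encode-slot s (suc x) with splitAt (suc p) x | Fin.join-splitAt (suc p) (suc p + suc p) x
  ... | inj₁ i | refl = refl
  ... | inj₂ y | refl with splitAt (suc p) y | Fin.join-splitAt (suc p) (suc p) y
  ...   | inj₁ i | refl = refl
  ...   | inj₂ i | refl = refl

  encode-decode : ∀ x → encode (decode x) ≡ x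
  encode-decode x = trans (encode-slot (proj₁ (remQuot {suc t} size x)) _) (Fin.combine-remQuot {suc t} size x)

  encode-injective : ∀ {v w} → encode v ≡ encode w → v ≡ w
  encode-injective {v} {w} eq = trans (sym (decode-encode v)) (trans (cong decode eq) (decode-encode w))

  decode-injective : ∀ {x y} → decode x ≡ decode y → x ≡ y
  decode-injective {x} {y} eq = trans (sym (encode-decode x)) (trans (cong encode eq) (encode-decode y))

  -- Sums over numbered vertices are brought into this form, in which each kind of vertex is
  -- evaluated on its own.
  ∑ⱽ : (Vertex → ℕ) → ℕ
  ∑ⱽ f = ∑[ s < suc t ] (f (apex s) + (∑[ i < suc p ] f (core s i) +
           (∑[ i < suc p ] f (row s false i) + ∑[ i < suc p ] f (row s true i))))

  ∑-decode : ∀ (f : Vertex → ℕ) → ∑[ x < suc t * size ] f (decode x) ≡ ∑ⱽ f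
  ∑-decode f = trans (∑-* (suc t) {size} (f ∘ decode)) (sum-cong-≗ λ s →
    trans (sum-cong-≗ λ x → cong f (decode-combine s x))
      (cong (f (apex s) +_) (trans (∑-+ (suc p) (λ x → f (slot s (suc x))))
        (cong₂ _+_ (sum-cong-≗ λ i → cong f (slot-place (core s i)))
          (trans (∑-+ (suc p) (λ x → f (slot s (suc (suc p ↑ʳ x)))))
            (cong₂ _+_ (sum-cong-≗ λ i → cong f (slot-place (row s false i)))
                       (sum-cong-≗ λ i → cong f (slot-place (row s true i)))))))))

  hub : Adj (suc t * size)
  hub x y = joined (decode x) (decode y)

  -- Degrees and the number of edges

  degree : Vertex → ℕ
  degree v = ∑ⱽ λ w → ⟦ joined v w ⟧

  deg-hub : ∀ x → deg hub x ≡ degree (decode x)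
  deg-hub x = trans (deg-∑ hub x) (∑-decode λ w → ⟦ joined (decode x) w ⟧)

  joined-sym : ∀ v w → joined v w ≡ joined w v
  joined-sym (row s σ i) (row s′ τ j) =
    cong₂ _∧_ (≟-sym s s′) (cong₂ _∧_ (bool-sym σ τ) (cong not (≟-sym i j)))
    where
    bool-sym : ∀ σ τ → ⌊ σ Bool.≟ τ ⌋ ≡ ⌊ τ Bool.≟ σ ⌋
    bool-sym false false = refl
    bool-sym false true  = refl
    bool-sym true  false = refl
    bool-sym true  true  = refl
  joined-sym (row s σ i) (core s′ j)  = cong₂ _∧_ (≟-sym s s′) (≟-sym i j)
  joined-sym (row s σ i) (apex s′)    = refl
  joined-sym (core s i)  (row s′ τ j) = cong₂ _∧_ (≟-sym s s′) (≟-sym i j)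
  joined-sym (core s i)  (core s′ j)  = cong₂ _∧_ (≟-sym s s′) (cong not (≟-sym i j))
  joined-sym (core s i)  (apex s′)    = ≟-sym s s′
  joined-sym (apex s)    (row s′ τ j) = refl
  joined-sym (apex s)    (core s′ j)  = ≟-sym s s′
  joined-sym (apex s)    (apex s′)    = refl

  joined-irrefl : ∀ v → joined v v ≡ false
  joined-irrefl (row s σ i)
    rewrite ⌊⌋-true (s ≟ s) refl | ⌊⌋-true (σ Bool.≟ σ) refl | ⌊⌋-true (i ≟ i) refl = refl
  joined-irrefl (core s i) rewrite ⌊⌋-true (s ≟ s) refl | ⌊⌋-true (i ≟ i) refl = refl
  joined-irrefl (apex s) = refl

  hub-simple : IsSimple hub
  hub-simple = (λ x y → joined-sym (decode x) (decode y)) , (λ x → joined-irrefl (decode x))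

  -- There are `p` neighbours in the same row, one matched core vertex and one apex. The apex term
  -- is split off first because `home s i` may lie in another block, while all other neighbours lie
  -- in block `s`.
  degree-row : ∀ s σ i → degree (row s σ i) ≡ 2 + p
  degree-row s σ i = begin
    degree (row s σ i)
      ≡⟨ ∑-distrib-+ (λ s′ → ⟦ ⌊ home s i ≟ s′ ⌋ ⟧) inBlock ⟩
    ∑[ s′ < suc t ] ⟦ ⌊ home s i ≟ s′ ⌋ ⟧ + ∑ inBlock
      ≡⟨ cong₂ _+_ (∑-≟ (home s i)) (∑-pick s inBlock elsewhere) ⟩
    1 + inBlock s
      ≡⟨ cong suc (here σ) ⟩
    2 + p ∎
    where
    open ≡-Reasoning
    inBlock : Fin (suc t) → ℕ
    inBlock s′ = ∑[ j < suc p ] ⟦ joined (row s σ i) (core s′ j) ⟧ +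
      (∑[ j < suc p ] ⟦ joined (row s σ i) (row s′ false j) ⟧ + ∑[ j < suc p ] ⟦ joined (row s σ i) (row s′ true j) ⟧)
    zeros : ∀ {n} → ∑[ j < n ] 0 ≡ 0
    zeros {n} = sum-replicate-zero n
    elsewhere : ∀ s′ → s ≢ s′ → inBlock s′ ≡ 0
    elsewhere s′ s≢s′ rewrite ⌊⌋-false (s ≟ s′) s≢s′ = cong₂ _+_ (zeros {p}) (cong₂ _+_ (zeros {p}) (zeros {p}))
    here : ∀ τ → ∑[ j < suc p ] ⟦ ⌊ s ≟ s ⌋ ∧ ⌊ i ≟ j ⌋ ⟧ +
      (∑[ j < suc p ] ⟦ ⌊ s ≟ s ⌋ ∧ ⌊ τ Bool.≟ false ⌋ ∧ not ⌊ i ≟ j ⌋ ⟧ +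
       ∑[ j < suc p ] ⟦ ⌊ s ≟ s ⌋ ∧ ⌊ τ Bool.≟ true ⌋ ∧ not ⌊ i ≟ j ⌋ ⟧) ≡ suc p
    here false rewrite ⌊⌋-true (s ≟ s) refl =
      cong₂ _+_ (∑-≟ i) (trans (cong₂ _+_ (∑-≢ i) (zeros {p})) (ℕ.+-identityʳ p))
    here true rewrite ⌊⌋-true (s ≟ s) refl = cong₂ _+_ (∑-≟ i) (cong₂ _+_ (zeros {p}) (∑-≢ i))

  -- The neighbours are one apex, `p` core vertices and one partner in each of the two rows, all in
  -- block `s`.
  degree-core : ∀ s i → degree (core s i) ≡ 3 + p
  degree-core s i = trans (∑-pick s inBlock elsewhere) here
    where
    inBlock : Fin (suc t) → ℕ
    inBlock s′ = ⟦ ⌊ s ≟ s′ ⌋ ⟧ + (∑[ j < suc p ] ⟦ joined (core s i) (core s′ j) ⟧ +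
      (∑[ j < suc p ] ⟦ joined (core s i) (row s′ false j) ⟧ + ∑[ j < suc p ] ⟦ joined (core s i) (row s′ true j) ⟧))
    zeros : ∀ {n} → ∑[ j < n ] 0 ≡ 0
    zeros {n} = sum-replicate-zero n
    elsewhere : ∀ s′ → s ≢ s′ → inBlock s′ ≡ 0
    elsewhere s′ s≢s′ rewrite ⌊⌋-false (s ≟ s′) s≢s′ = cong₂ _+_ (zeros {p}) (cong₂ _+_ (zeros {p}) (zeros {p}))
    here : inBlock s ≡ 3 + p
    here rewrite ⌊⌋-true (s ≟ s) refl | ∑-≢ i | ∑-≟ i = cong suc (ℕ.+-comm p 2)

  -- Counts neighbours among the rows of one fixed side only. Both sides behave alike, so the degree
  -- of an apex contains this number twice.
  attached : Fin (suc t) → ℕ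
  attached s = ∑[ s′ < suc t ] ∑[ j < suc p ] ⟦ ⌊ home s′ j ≟ s ⌋ ⟧

  degree-apex : ∀ s → degree (apex s) ≡ suc p + (attached s + attached s)
  degree-apex s = begin
    degree (apex s)
      ≡⟨ ∑-distrib-+ (λ s′ → ∑[ j < suc p ] ⟦ ⌊ s ≟ s′ ⌋ ⟧) (λ s′ → rows s′ + rows s′) ⟩
    ∑[ s′ < suc t ] ∑[ j < suc p ] ⟦ ⌊ s ≟ s′ ⌋ ⟧ + ∑[ s′ < suc t ] (rows s′ + rows s′)
      ≡⟨ cong₂ _+_ (trans (∑-comm {suc t} {suc p} λ s′ j → ⟦ ⌊ s ≟ s′ ⌋ ⟧)
                          (trans (sum-cong-≗ {suc p} λ j → ∑-≟ s) (trans (∑-const (suc p) 1) (ℕ.*-identityʳ (suc p)))))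
                   (∑-distrib-+ rows rows) ⟩
    suc p + (attached s + attached s) ∎
    where
    open ≡-Reasoning
    rows : Fin (suc t) → ℕ
    rows s′ = ∑[ j < suc p ] ⟦ ⌊ home s′ j ≟ s ⌋ ⟧

  -- Only the vertex with index `zero` in a row can see an apex other than the hub. Such an apex has
  -- one neighbour in each row of its block, which brings it exactly to the degree of a core vertex.
  degree-apex-suc : ∀ s → degree (apex (suc s)) ≡ 3 + p
  degree-apex-suc s = trans (degree-apex (suc s)) (trans (cong (λ a → suc p + (a + a)) one) (ℕ.+-comm (suc p) 2))
    where
    one : attached (suc s) ≡ 1
    one = trans (sum-cong-≗ {suc t} λ s′ → trans (cong₂ _+_ (cong ⟦_⟧ (≟-sym s′ (suc s))) (sum-replicate-zero p)) (ℕ.+-identityʳ _))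
                (∑-≟ (suc s))

  attached≥1 : ∀ s → 1 ≤ attached s
  attached≥1 s = ℕ.≤-trans (ℕ.≤-reflexive (sym (cong ⟦_⟧ (⌊⌋-true (s ≟ s) refl))))
    (ℕ.≤-trans (ℕ.m≤m+n _ _) (term≤∑ (λ s′ → ∑[ j < suc p ] ⟦ ⌊ home s′ j ≟ s ⌋ ⟧) s))

  core≤apex : ∀ s → 3 + p ≤ degree (apex s)
  core≤apex s = begin
    3 + p                                 ≡⟨ ℕ.+-comm 2 (suc p) ⟩
    suc p + 2                             ≤⟨ ℕ.+-monoʳ-≤ (suc p) (ℕ.+-mono-≤ (attached≥1 s) (attached≥1 s)) ⟩
    suc p + (attached s + attached s)     ≡⟨ degree-apex s ⟨
    degree (apex s)                       ∎
    where open ℕ.≤-Reasoning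

  -- The degrees of the apexes are uneven, but every row vertex sees exactly one apex, so their
  -- total follows by double counting.
  ∑-degree-apex : ∑[ s < suc t ] degree (apex s) ≡ suc t * (3 * suc p)
  ∑-degree-apex = begin
    ∑[ s < suc t ] degree (apex s)
      ≡⟨ sum-cong-≗ degree-apex ⟩
    ∑[ s < suc t ] (suc p + (attached s + attached s))
      ≡⟨ ∑-distrib-+ {suc t} (λ s → suc p) (λ s → attached s + attached s) ⟩
    ∑[ s < suc t ] suc p + ∑[ s < suc t ] (attached s + attached s)
      ≡⟨ cong₂ _+_ (∑-const (suc t) (suc p)) (∑-distrib-+ attached attached) ⟩
    suc t * suc p + (∑ attached + ∑ attached)
      ≡⟨ cong (λ a → suc t * suc p + (a + a)) total ⟩
    suc t * suc p + (suc t * suc p + suc t * suc p)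
      ≡⟨ arith (suc t) (suc p) ⟩
    suc t * (3 * suc p) ∎
    where
    open ≡-Reasoning
    arith : ∀ a b → a * b + (a * b + a * b) ≡ a * (3 * b)
    arith = solve-∀
    total : ∑ attached ≡ suc t * suc p
    total = begin
      ∑ attached
        ≡⟨ ∑-comm {suc t} {suc t} (λ s s′ → ∑[ j < suc p ] ⟦ ⌊ home s′ j ≟ s ⌋ ⟧) ⟩
      ∑[ s′ < suc t ] ∑[ s < suc t ] ∑[ j < suc p ] ⟦ ⌊ home s′ j ≟ s ⌋ ⟧
        ≡⟨ (sum-cong-≗ {suc t} λ s′ → ∑-comm {suc t} {suc p} λ s j → ⟦ ⌊ home s′ j ≟ s ⌋ ⟧) ⟩
      ∑[ s′ < suc t ] ∑[ j < suc p ] ∑[ s < suc t ] ⟦ ⌊ home s′ j ≟ s ⌋ ⟧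
        ≡⟨ (sum-cong-≗ {suc t} λ s′ → sum-cong-≗ {suc p} λ j → ∑-≟ (home s′ j)) ⟩
      ∑[ s′ < suc t ] ∑[ j < suc p ] 1
        ≡⟨ (sum-cong-≗ {suc t} λ s′ → trans (∑-const (suc p) 1) (ℕ.*-identityʳ (suc p))) ⟩
      ∑[ s′ < suc t ] suc p
        ≡⟨ ∑-const (suc t) (suc p) ⟩
      suc t * suc p ∎

  edgeCount-hub : 2 * edgeCount hub ≡ suc t * (suc p * (10 + 3 * p))
  edgeCount-hub = begin
    2 * edgeCount hub
      ≡⟨ handshake hub hub-simple ⟩
    ∑[ x < suc t * size ] deg hub x
      ≡⟨ sum-cong-≗ deg-hub ⟩
    ∑[ x < suc t * size ] degree (decode x)
      ≡⟨ ∑-decode degree ⟩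
    ∑ⱽ degree
      ≡⟨ ∑-distrib-+ (λ s → degree (apex s)) others ⟩
    ∑[ s < suc t ] degree (apex s) + ∑ others
      ≡⟨ cong₂ _+_ ∑-degree-apex (trans (sum-cong-≗ {suc t} λ s →
           cong₂ _+_ (trans (sum-cong-≗ (degree-core s)) (∑-const (suc p) (3 + p)))
             (cong₂ _+_ (trans (sum-cong-≗ (degree-row s false)) (∑-const (suc p) (2 + p)))
                        (trans (sum-cong-≗ (degree-row s true)) (∑-const (suc p) (2 + p)))))
           (∑-const (suc t) _)) ⟩
    suc t * (3 * suc p) + suc t * (suc p * (3 + p) + (suc p * (2 + p) + suc p * (2 + p)))
      ≡⟨ arith (suc t) (suc p) p ⟩
    suc t * (suc p * (10 + 3 * p)) ∎
    where
    open ≡-Reasoning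
    arith : ∀ a b p → a * (3 * b) + a * (b * (3 + p) + (b * (2 + p) + b * (2 + p))) ≡ a * (b * (10 + 3 * p))
    arith = solve-∀
    others : Fin (suc t) → ℕ
    others s = ∑[ i < suc p ] degree (core s i) + (∑[ i < suc p ] degree (row s false i) + ∑[ i < suc p ] degree (row s true i))

  -- Degree monotone paths in the hub graph

  Line : Set
  Line = (Fin (suc t) × Bool) ⊎ Fin (suc t)

  -- The apex shares a line with its core because both belong to the upper degree level, so a
  -- monotone path can visit both without changing level.
  line : Vertex → Line
  line (row s σ i) = inj₁ (s , σ)
  line (core s i)  = inj₂ s
  line (apex s)    = inj₂ s

  IsRow IsCore : Line → Set
  IsRow a = ∃ λ ρ → a ≡ inj₁ ρ
  IsCore a = ∃ λ s → a ≡ inj₂ s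

  row-or-core : ∀ a → IsRow a ⊎ IsCore a
  row-or-core (inj₁ ρ) = inj₁ (ρ , refl)
  row-or-core (inj₂ s) = inj₂ (s , refl)

  row-not-core : ∀ {a} → IsRow a → IsCore a → ⊥
  row-not-core (_ , refl) (_ , ())

  degree-in-row : ∀ v → IsRow (line v) → degree v ≡ 2 + p
  degree-in-row (row s σ i) _ = degree-row s σ i

  degree-in-core : ∀ v → IsCore (line v) → 3 + p ≤ degree v
  degree-in-core (core s i) _ = ℕ.≤-reflexive (sym (degree-core s i))
  degree-in-core (apex s) _ = core≤apex s

  -- This gap in degrees makes every edge between a row and a core line one-way on a monotone path.
  row<core : ∀ v w → IsRow (line v) → IsCore (line w) → degree v < degree w
  row<core v w r c rewrite degree-in-row v r = degree-in-core w c

  joined-lines : ∀ v w → joined v w ≡ true →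
    line v ≡ line w ⊎ (IsRow (line v) × IsCore (line w)) ⊎ (IsCore (line v) × IsRow (line w))
  joined-lines (row s σ i) (row s′ τ j) e with s ≟ s′ | σ Bool.≟ τ
  ... | yes refl | yes refl = inj₁ refl
  joined-lines (row s σ i) (core s′ j) e = inj₂ (inj₁ ((_ , refl) , (_ , refl)))
  joined-lines (row s σ i) (apex s′) e = inj₂ (inj₁ ((_ , refl) , (_ , refl)))
  joined-lines (core s i) (row s′ τ j) e = inj₂ (inj₂ ((_ , refl) , (_ , refl)))
  joined-lines (core s i) (core s′ j) e with s ≟ s′
  ... | yes refl = inj₁ refl
  joined-lines (core s i) (apex s′) e with s ≟ s′
  ... | yes refl = inj₁ refl
  joined-lines (apex s) (row s′ τ j) e = inj₂ (inj₂ ((_ , refl) , (_ , refl)))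
  joined-lines (apex s) (core s′ j) e with s ≟ s′
  ... | yes refl = inj₁ refl

  -- Position within a row, or within a core together with its apex.
  index : Vertex → Fin (suc p) ⊎ Fin (suc (suc p))
  index (row s σ i) = inj₁ i
  index (core s i)  = inj₂ (suc i)
  index (apex s)    = inj₂ zero

  index-line-injective : ∀ v w → line v ≡ line w → index v ≡ index w → v ≡ w
  index-line-injective (row s σ i) (row _ _ _) refl refl = refl
  index-line-injective (core s i) (core _ _) refl refl = refl
  index-line-injective (apex s) (apex _) refl refl = refl

  -- The tag of an index tells rows from core lines, and here only one line of each sort is
  -- available.
  index⇒line : ∀ v w {ρ s} → line v ≡ inj₁ ρ ⊎ line v ≡ inj₂ s → line w ≡ inj₁ ρ ⊎ line w ≡ inj₂ s →
    index v ≡ index w → line v ≡ line w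
  index⇒line v w (inj₁ e) (inj₁ f) _ = trans e (sym f)
  index⇒line v w (inj₂ e) (inj₂ f) _ = trans e (sym f)
  index⇒line (row _ _ _) (core _ _) (inj₁ e) (inj₂ f) ()
  index⇒line (row _ _ _) (apex _) (inj₁ e) (inj₂ f) ()
  index⇒line (core _ _) (row _ _ _) (inj₂ e) (inj₁ f) ()
  index⇒line (apex _) (row _ _ _) (inj₂ e) (inj₁ f) ()

  -- This is `k = 2p + 4`, one more than the number of vertices in a row and a core with its apex.
  threshold : ℕ
  threshold = suc (suc p + suc (suc p))

  -- Pigeonhole: on one row and one core line the index determines the vertex, so the path injects
  -- into `suc p + suc (suc p)` positions.
  two-lines-short : ∀ {vs ρ s} → Unique vs →
    All (λ x → line (decode x) ≡ inj₁ ρ ⊎ line (decode x) ≡ inj₂ s) vs → length vs < threshold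
  two-lines-short {vs} u lines = s≤s (Fin.injective⇒≤ {f = place′} λ {i} {j} eq →
    lookup-injective u (decode-injective (same i j (join-injective eq))))
    where
    place′ : Fin (length vs) → Fin (suc p + suc (suc p))
    place′ i = join (suc p) (suc (suc p)) (index (decode (lookup vs i)))
    join-injective : ∀ {m n} {a b : Fin m ⊎ Fin n} → join m n a ≡ join m n b → a ≡ b
    join-injective {m} {n} {a} {b} eq =
      trans (sym (Fin.splitAt-join m n a)) (trans (cong (splitAt m) eq) (Fin.splitAt-join m n b))
    same : ∀ i j → index (decode (lookup vs i)) ≡ index (decode (lookup vs j)) →
      decode (lookup vs i) ≡ decode (lookup vs j)
    same i j eq = index-line-injective _ _
      (index⇒line _ _ (All.lookup lines (∈-lookup i)) (All.lookup lines (∈-lookup j)) eq) eq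

  ascend : ∀ x y → hub x y ≡ true → deg hub x ≤ deg hub y →
    line (decode x) ≡ line (decode y) ⊎ (IsRow (line (decode x)) × IsCore (line (decode y)))
  ascend x y e d with joined-lines (decode x) (decode y) e
  ... | inj₁ same = inj₁ same
  ... | inj₂ (inj₁ up) = inj₂ up
  ... | inj₂ (inj₂ (c , r)) = contradiction (row<core (decode y) (decode x) r c)
    (ℕ.≤⇒≯ (subst₂ _≤_ (deg-hub x) (deg-hub y) d))

  descend : ∀ x y → hub x y ≡ true → deg hub x ≥ deg hub y →
    line (decode x) ≡ line (decode y) ⊎ (IsCore (line (decode x)) × IsRow (line (decode y)))
  descend x y e d with ascend y x (trans (hub-simple .proj₁ y x) e) d
  ... | inj₁ same = inj₁ (sym same)
  ... | inj₂ (r , c) = inj₂ (c , r)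

  hub-mpLt : mpLt hub threshold
  hub-mpLt vs ((u , adj) , inj₁ asc)
    -- The row and the core line of block `zero` are arbitrary defaults for a path that meets no row
    -- or no core line.
    with two-phases {P = IsRow} {Q = IsCore} row-not-core {inj₁ (zero , false)} {inj₂ zero} (_ , refl) (_ , refl) row-or-core
           (Linked.map⁺ (Linked.zipWith (λ {x} {y} (e , d) → ascend x y e d) (adj , asc)))
  ... | _ , _ , (_ , refl) , (_ , refl) , lines = two-lines-short u (All.map⁻ lines)
  hub-mpLt vs ((u , adj) , inj₂ desc)
    with two-phases {P = IsCore} {Q = IsRow} (λ c r → row-not-core r c) {inj₂ zero} {inj₁ (zero , false)} (_ , refl) (_ , refl)
           ([ inj₂ , inj₁ ]′ ∘ row-or-core)
           (Linked.map⁺ (Linked.zipWith (λ {x} {y} (e , d) → descend x y e d) (adj , desc)))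
  ... | _ , _ , (_ , refl) , (_ , refl) , lines =
    two-lines-short u (All.map (λ {x} → [ inj₂ , inj₁ ]′) (All.map⁻ lines))

  -- Ascending paths after the addition of an edge

  joined-row : ∀ s σ {i j} → i ≢ j → joined (row s σ i) (row s σ j) ≡ true
  joined-row s σ {i} {j} i≢j
    rewrite ⌊⌋-true (s ≟ s) refl | ⌊⌋-true (σ Bool.≟ σ) refl | ⌊⌋-false (i ≟ j) i≢j = refl

  joined-core : ∀ s {i j} → i ≢ j → joined (core s i) (core s j) ≡ true
  joined-core s {i} {j} i≢j rewrite ⌊⌋-true (s ≟ s) refl | ⌊⌋-false (i ≟ j) i≢j = refl

  joined-match : ∀ s σ i → joined (row s σ i) (core s i) ≡ true
  joined-match s σ i rewrite ⌊⌋-true (s ≟ s) refl | ⌊⌋-true (i ≟ i) refl = refl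

  joined-home : ∀ s σ → joined (row s σ zero) (apex s) ≡ true
  joined-home s σ = ⌊⌋-true (s ≟ s) refl

  joined-apex : ∀ s i → joined (core s i) (apex s) ≡ true
  joined-apex s i = ⌊⌋-true (s ≟ s) refl

  module Extension (u v : Vertex) (u≢v : u ≢ v) (nonadjacent : joined u v ≡ false) where

    hub⁺ : Adj (suc t * size)
    hub⁺ = addEdge hub (encode u) (encode v)

    degree⁺ : Vertex → ℕ
    degree⁺ w = deg hub⁺ (encode w)

    -- All paths demanded by saturation are built ascending. A record lets `a` and `b` be read off
    -- from the type.
    record Step (a b : Vertex) : Set where
      constructor _,_
      field
        edge   : hub⁺ (encode a) (encode b) ≡ true
        ascent : degree⁺ a ≤ degree⁺ b

    hub-encode : ∀ a b → hub (encode a) (encode b) ≡ joined a b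
    hub-encode a b = cong₂ joined (decode-encode a) (decode-encode b)

    deg-encode : ∀ a → deg hub (encode a) ≡ degree a
    deg-encode a = trans (deg-hub (encode a)) (cong degree (decode-encode a))

    degree⁺-other : ∀ {a} → a ≢ u → a ≢ v → degree⁺ a ≡ degree a
    degree⁺-other {a} a≢u a≢v = trans
      (deg-addEdge-other hub (encode u) (encode v) (a≢u ∘ encode-injective) (a≢v ∘ encode-injective)) (deg-encode a)

    degree⁺-u : degree⁺ u ≡ suc (degree u)
    degree⁺-u = trans (deg-addEdge-end hub (u≢v ∘ encode-injective) (trans (hub-encode u v) nonadjacent))
      (cong suc (deg-encode u))

    degree⁺-v : degree⁺ v ≡ suc (degree v)
    degree⁺-v = trans (deg-cong (addEdge-comm hub (encode u) (encode v)) (encode v))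
      (trans (deg-addEdge-end hub (u≢v ∘ sym ∘ encode-injective)
        (trans (hub-encode v u) (trans (joined-sym v u) nonadjacent)))
      (cong suc (deg-encode v)))

    degree≤degree⁺ : ∀ a → degree a ≤ degree⁺ a
    degree≤degree⁺ a = subst (_≤ degree⁺ a) (deg-encode a) (deg≤deg-addEdge hub (encode u) (encode v) (encode a))

    keep : ∀ a b → joined a b ≡ true → hub⁺ (encode a) (encode b) ≡ true
    keep a b e = addEdge-keeps hub (encode u) (encode v) {encode a} {encode b} (trans (hub-encode a b) e)

    -- Only the source has to avoid the new edge: the degree of the target can only grow, so the
    -- comparison of old degrees suffices.
    step : ∀ {a b} → a ≢ u → a ≢ v → joined a b ≡ true → degree a ≤ degree b → Step a b
    step {a} {b} a≢u a≢v e d =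
      keep a b e , ℕ.≤-trans (ℕ.≤-reflexive (degree⁺-other a≢u a≢v)) (ℕ.≤-trans d (degree≤degree⁺ b))

    -- The new edge raises `u` by one, so `a` may exceed its old degree by one. This is what lets a
    -- path return from a core to a row vertex `u`.
    step-to-u : ∀ {a} → a ≢ u → a ≢ v → joined a u ≡ true → degree a ≤ suc (degree u) → Step a u
    step-to-u {a} a≢u a≢v e d = keep a u e , subst₂ _≤_ (sym (degree⁺-other a≢u a≢v)) (sym degree⁺-u) d

    step-new : degree u ≤ degree v → Step u v
    step-new d = addEdge-new hub (encode u) (encode v) , subst₂ _≤_ (sym degree⁺-u) (sym degree⁺-v) (s≤s d)

    -- Since `v` has gained a neighbour, its successor must exceed the old degree of `v`.
    step-from-v : ∀ {b} → joined v b ≡ true → suc (degree v) ≤ degree b → Step v b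
    step-from-v {b} e d = keep v b e , ℕ.≤-trans (ℕ.≤-reflexive degree⁺-v) (ℕ.≤-trans d (degree≤degree⁺ b))

    long : ∀ {h vs z} → Chain Step h vs z → Unique vs → length vs ≡ threshold → mpGe hub⁺ threshold
    long {vs = vs} c uniq len = map encode vs ,
      ((Unique.map⁺ encode-injective uniq , Linked.map⁺ (Linked.map Step.edge l)) , inj₁ (Linked.map⁺ (Linked.map Step.ascent l))) ,
      ℕ.≤-reflexive (sym (trans (List.length-map encode vs) len))
      where
      l : Linked Step vs
      l = chain⇒linked c

  -- Saturation, by the kinds of the two nonadjacent vertices

  Extensible : Vertex → Vertex → Set
  Extensible u v = u ≢ v → joined u v ≡ false → mpGe (addEdge hub (encode u) (encode v)) threshold

  rows≤ : ∀ s σ i τ j → degree (row s σ i) ≤ degree (row s τ j)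
  rows≤ s σ i τ j = ℕ.≤-reflexive (trans (degree-row s σ i) (sym (degree-row s τ j)))

  cores≤ : ∀ s i j → degree (core s i) ≤ degree (core s j)
  cores≤ s i j = ℕ.≤-reflexive (trans (degree-core s i) (sym (degree-core s j)))

  core≤apex′ : ∀ s i s′ → degree (core s i) ≤ degree (apex s′)
  core≤apex′ s i s′ = subst (_≤ degree (apex s′)) (sym (degree-core s i)) (core≤apex s′)

  apex≤core : ∀ s i → degree (apex (suc s)) ≤ degree (core (suc s) i)
  apex≤core s i = ℕ.≤-reflexive (trans (degree-apex-suc s) (sym (degree-core (suc s) i)))

  row-injective : ∀ {s σ i j} → row s σ i ≡ row s σ j → i ≡ j
  row-injective refl = refl

  row-flip≢ : ∀ σ {s s′ a b} → row s (not σ) a ≢ row s′ σ b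
  row-flip≢ false ()
  row-flip≢ true ()

  -- Two distinct indices force `1 ≤ p`. All vertices in both rows of block `zero` see the hub, so
  -- it has at least four row neighbours. For `p = 0` the hub would only have the degree of a core
  -- vertex.
  core<hub : ∀ {i j : Fin (suc p)} → j ≢ i → 4 + p ≤ degree (apex zero)
  core<hub {i} {j} j≢i = begin
    4 + p                                      ≡⟨ ℕ.+-comm 3 (suc p) ⟩
    suc p + 3                                  ≤⟨ ℕ.+-monoʳ-≤ (suc p) (ℕ.≤-trans (ℕ.n≤1+n 3) (ℕ.+-mono-≤ two two)) ⟩
    suc p + (attached zero + attached zero)    ≡⟨ degree-apex zero ⟨
    degree (apex zero)                         ∎
    where
    open ℕ.≤-Reasoning
    home-zero : ∀ i → home zero i ≡ zero
    home-zero zero = refl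
    home-zero (suc _) = refl
    1≤ : ∀ {n} {i j : Fin (suc n)} → j ≢ i → 1 ≤ n
    1≤ {zero} {zero} {zero} j≢i = contradiction refl j≢i
    1≤ {suc n} _ = s≤s z≤n
    two : 2 ≤ attached zero
    two = begin
      2
        ≤⟨ s≤s (1≤ j≢i) ⟩
      suc p
        ≡⟨ trans (∑-const (suc p) 1) (ℕ.*-identityʳ (suc p)) ⟨
      ∑[ i < suc p ] 1
        ≡⟨ (sum-cong-≗ {suc p} λ i → cong ⟦_⟧ (⌊⌋-true (home zero i ≟ zero) (home-zero i))) ⟨
      ∑[ i < suc p ] ⟦ ⌊ home zero i ≟ zero ⌋ ⟧
        ≤⟨ term≤∑ (λ s → ∑[ i < suc p ] ⟦ ⌊ home s i ≟ zero ⌋ ⟧) zero ⟩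
      attached zero ∎

  core-injective : ∀ {s i j} → core s i ≡ core s j → i ≡ j
  core-injective refl = refl

  -- The path runs through the row of `u` up to `u`, crosses to `v`, tours the core matched with `v`
  -- and ends in its apex. The new edge lifts `v` just to the degree of the core, so the ascent can
  -- go on.
  row-row : ∀ s σ i s′ τ j → (s , σ) ≢ (s′ , τ) → Extensible (row s σ i) (row s′ τ j)
  row-row s σ i s′ τ j other u≢v nonadj =
    let h , xs , c , uxs , lxs = tour-to i
        ys , z , d , uys , lys = tour-from j
    in long
    (chain-++
      (chain-map (row s σ) (λ {a} {b} (a≢b , a≢i) → step (a≢i ∘ row-injective) not-v (joined-row s σ a≢b) (rows≤ s σ a σ b)) c)
      (step-new (ℕ.≤-reflexive (trans (degree-row s σ i) (sym (degree-row s′ τ j)))))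
      (step-from-v (joined-match s′ τ j) (ℕ.≤-reflexive (trans (cong suc (degree-row s′ τ j)) (sym (degree-core s′ j)))) ∷
       chain-++
         (chain-map (core s′) (λ {a} {b} a≢b → step (λ ()) (λ ()) (joined-core s′ a≢b) (cores≤ s′ a b)) d)
         (step (λ ()) (λ ()) (joined-apex s′ z) (core≤apex′ s′ z s′))
         ([-] {x = apex s′})))
    (unique-map-++ row-injective uxs
      ((λ _ → not-v) ∷ all-map-++ (λ _ _ ()) ys ((λ _ ()) ∷ []))
      (all-map-++ (λ _ ()) ys ((λ ()) ∷ []) ∷
       unique-map-++ core-injective uys ((λ _ ()) ∷ []) ([] ∷ [])))
    (trans (length-map-++ (row s σ) xs _ lxs)
      (cong (λ l → suc p + suc l) (length-map-++ (core s′) ys _ lys) ⟨ trans ⟩ arith p))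
    where
    open Extension (row s σ i) (row s′ τ j) u≢v nonadj
    not-v : ∀ {a} → row s σ a ≢ row s′ τ j
    not-v refl = other refl
    arith : ∀ p → suc p + suc (suc p + 1) ≡ suc (suc p + suc (suc p))
    arith = solve-∀

  -- The path uses up a row and the whole core of the block of u before it reaches u.
  row-far-core : ∀ s σ i v → (∀ τ a → row s τ a ≢ v) → (∀ a → core s a ≢ v) → 2 + p ≤ degree v →
    Extensible (row s σ i) v
  row-far-core s σ i v not-row not-core v-degree u≢v nonadj =
    let h , ys , d , uys , lys = tour-to i
        _ , xs , c , uxs , lxs = tour-to h
    in long
    (chain-++
      (chain-map (row s (not σ))
        (λ {a} {b} (a≢b , _) → step (row-flip≢ σ) (not-row _ _) (joined-row s (not σ) a≢b) (rows≤ s (not σ) a (not σ) b)) c)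
      (step (row-flip≢ σ) (not-row _ _) (joined-match s (not σ) h)
        (ℕ.<⇒≤ (row<core (row s (not σ) h) (core s h) (_ , refl) (_ , refl))))
      (chain-++
        (chain-map (core s) (λ {a} {b} (a≢b , _) → step (λ ()) (not-core _) (joined-core s a≢b) (cores≤ s a b)) d)
        (step-to-u (λ ()) (not-core _) (joined-match s σ i)
          (ℕ.≤-reflexive (trans (degree-core s i) (cong suc (sym (degree-row s σ i))))))
        (step-new (subst (_≤ degree v) (sym (degree-row s σ i)) v-degree) ∷ [-])))
    (unique-map-++ row-injective uxs
      (all-map-++ (λ _ _ ()) ys ((λ _ → row-flip≢ σ) ∷ not-row _ ∷ []))
      (unique-map-++ core-injective uys ((λ _ ()) ∷ not-core ∷ []) ((u≢v ∷ []) ∷ [] ∷ [])))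
    (trans (length-map-++ (row s (not σ)) xs _ lxs)
      (cong (suc p +_) (length-map-++ (core s) ys _ lys) ⟨ trans ⟩ arith p))
    where
    open Extension (row s σ i) v u≢v nonadj
    arith : ∀ p → suc p + (suc p + 2) ≡ suc (suc p + suc (suc p))
    arith = solve-∀

  -- In block 0 the apex is the hub, whose degree is large enough to end the path.
  row-near-core-zero : ∀ σ i j → Extensible (row zero σ i) (core zero j)
  row-near-core-zero σ i j u≢v nonadj =
    -- The core vertex `j` is held back, since it is to be reached over the new edge. The tour of
    -- the others ends in `i`, the partner of `u`.
    let h , ys , d , uys , ys≢j , lys = tour-avoiding i j j≢i
        _ , xs , c , uxs , lxs = tour-to h
    in long
    (chain-++
      (chain-map (row zero (not σ))
        (λ {a} {b} (a≢b , _) → step (row-flip≢ σ) (λ ()) (joined-row zero (not σ) a≢b) (rows≤ zero (not σ) a (not σ) b)) c)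
      (step (row-flip≢ σ) (λ ()) (joined-match zero (not σ) h)
        (ℕ.<⇒≤ (row<core (row zero (not σ) h) (core zero h) (_ , refl) (_ , refl))))
      (chain-++
        (chain-map (core zero)
          (λ {a} {b} (a≢j , a≢b) → step (λ ()) (a≢j ∘ core-injective) (joined-core zero a≢b) (cores≤ zero a b)) d)
        (step-to-u (λ ()) (j≢i ∘ sym ∘ core-injective) (joined-match zero σ i)
          (ℕ.≤-reflexive (trans (degree-core zero i) (cong suc (sym (degree-row zero σ i))))))
        (step-new (ℕ.<⇒≤ (row<core (row zero σ i) (core zero j) (_ , refl) (_ , refl))) ∷
         step-from-v (joined-apex zero j) (subst (λ x → suc x ≤ degree (apex zero)) (sym (degree-core zero j)) (core<hub j≢i)) ∷
         [-] {x = apex zero})))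
    (unique-map-++ row-injective uxs
      (all-map-++ (λ _ _ ()) ys ((λ _ → row-flip≢ σ) ∷ (λ _ ()) ∷ (λ _ ()) ∷ []))
      (AllPairs.++⁺ (Unique.map⁺ core-injective uys)
        (((λ ()) ∷ (λ ()) ∷ []) ∷ ((λ ()) ∷ []) ∷ [] ∷ [])
        (All.map⁺ (All.map (λ a≢j → (λ ()) ∷ (a≢j ∘ core-injective) ∷ (λ ()) ∷ []) ys≢j))))
    (trans (length-map-++ (row zero (not σ)) xs _ lxs)
      (cong (suc p +_) (length-map-++ (core zero) ys _ lys) ⟨ trans ⟩ arith p))
    where
    open Extension (row zero σ i) (core zero j) u≢v nonadj
    j≢i : j ≢ i
    j≢i refl = contradiction (trans (sym nonadj) (joined-match zero σ i)) λ ()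
    arith : ∀ p → suc p + (p + 3) ≡ suc (suc p + suc (suc p))
    arith = solve-∀

  -- An apex other than the hub is too small to follow `v`, whose degree has risen above that of the
  -- core. But having core degree, it can be inserted between the row and the core. The row is
  -- therefore left at index `zero`, whose vertex sees the apex of its own block.
  row-near-core-suc : ∀ s σ i j → Extensible (row (suc s) σ i) (core (suc s) j)
  row-near-core-suc s₋ σ i j u≢v nonadj =
    let h , ys , d , uys , ys≢j , lys = tour-avoiding i j j≢i
        _ , xs , c , uxs , lxs = tour-to zero
    in long
    (chain-++
      (chain-map (row s (not σ))
        (λ {a} {b} (a≢b , _) → step (row-flip≢ σ) (λ ()) (joined-row s (not σ) a≢b) (rows≤ s (not σ) a (not σ) b)) c)
      (step {b = apex s} (row-flip≢ σ) (λ ()) (joined-home s (not σ))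
        (ℕ.<⇒≤ (row<core (row s (not σ) zero) (apex s) (_ , refl) (_ , refl))))
      (step (λ ()) (λ ()) (joined-apex s h) (apex≤core s₋ h) ∷
       chain-++
        (chain-map (core s)
          (λ {a} {b} (a≢j , a≢b) → step (λ ()) (a≢j ∘ core-injective) (joined-core s a≢b) (cores≤ s a b)) d)
        (step-to-u (λ ()) (j≢i ∘ sym ∘ core-injective) (joined-match s σ i)
          (ℕ.≤-reflexive (trans (degree-core s i) (cong suc (sym (degree-row s σ i))))))
        (step-new (ℕ.<⇒≤ (row<core (row s σ i) (core s j) (_ , refl) (_ , refl))) ∷
         [-] {x = core s j})))
    (unique-map-++ row-injective uxs
      ((λ _ ()) ∷ all-map-++ (λ _ _ ()) ys ((λ _ → row-flip≢ σ) ∷ (λ _ ()) ∷ []))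
      (all-map-++ (λ _ ()) ys ((λ ()) ∷ (λ ()) ∷ []) ∷
       AllPairs.++⁺ (Unique.map⁺ core-injective uys)
        (((λ ()) ∷ []) ∷ [] ∷ [])
        (All.map⁺ (All.map (λ a≢j → (λ ()) ∷ (a≢j ∘ core-injective) ∷ []) ys≢j))))
    (trans (length-map-++ (row s (not σ)) xs _ lxs)
      (cong (λ l → suc p + suc l) (length-map-++ (core s) ys _ lys) ⟨ trans ⟩ arith p))
    where
    s : Fin (suc t)
    s = suc s₋
    open Extension (row s σ i) (core s j) u≢v nonadj
    j≢i : j ≢ i
    j≢i refl = contradiction (trans (sym nonadj) (joined-match s σ i)) λ ()
    arith : ∀ p → suc p + suc (p + 2) ≡ suc (suc p + suc (suc p))
    arith = solve-∀

  row≢core-line : ∀ {s σ i v} → IsCore (line v) → row s σ i ≢ v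
  row≢core-line (_ , ()) refl

  -- The path takes a row, the apex, the core up to `u`, and then `v`. Passing from the apex to the
  -- core needs equal degrees, so the block of `u` must not be that of the hub.
  core-far : ∀ s i v → IsCore (line v) → block v ≢ suc s → Extensible (core (suc s) i) v
  core-far s₋ i v v-core far u≢v nonadj =
    let h , ys , d , uys , lys = tour-to i
        _ , xs , c , uxs , lxs = tour-to zero
    in long
    (chain-++
      (chain-map (row s false)
        (λ {a} {b} (a≢b , _) → step (λ ()) (row≢core-line v-core) (joined-row s false a≢b) (rows≤ s false a false b)) c)
      (step {b = apex s} (λ ()) (row≢core-line v-core) (joined-home s false)
        (ℕ.<⇒≤ (row<core (row s false zero) (apex s) (_ , refl) (_ , refl))))
      (step (λ ()) apex≢v (joined-apex s h) (apex≤core s₋ h) ∷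
       chain-++
        (chain-map (core s)
          (λ {a} {b} (a≢b , a≢i) → step (a≢i ∘ core-injective) core≢v (joined-core s a≢b) (cores≤ s a b)) d)
        (step-new (subst (_≤ degree v) (sym (degree-core s i)) (degree-in-core v v-core)))
        ([-] {x = v})))
    (unique-map-++ row-injective uxs
      ((λ _ ()) ∷ all-map-++ (λ _ _ ()) ys ((λ _ → row≢core-line v-core) ∷ []))
      (all-map-++ (λ _ ()) ys (apex≢v ∷ []) ∷
       unique-map-++ core-injective uys ((λ _ → core≢v) ∷ []) ([] ∷ [])))
    (trans (length-map-++ (row s false) xs _ lxs)
      (cong (λ l → suc p + suc l) (length-map-++ (core s) ys _ lys) ⟨ trans ⟩ arith p))
    where
    s : Fin (suc t)
    s = suc s₋
    open Extension (core s i) v u≢v nonadj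
    apex≢v : apex s ≢ v
    apex≢v refl = far refl
    core≢v : ∀ {a} → core s a ≢ v
    core≢v refl = far refl
    arith : ∀ p → suc p + suc (suc p + 1) ≡ suc (suc p + suc (suc p))
    arith = solve-∀

  -- Here the apex is `u` itself and comes after the core. It is not the hub, so its degree does not
  -- exceed that of `v`.
  apex-far : ∀ s v → IsCore (line v) → block v ≢ suc s → Extensible (apex (suc s)) v
  apex-far s₋ v v-core far u≢v nonadj =
    -- Any common index would do: the row is left through its matching with the core.
    let ys , z , d , uys , lys = tour-from zero
        _ , xs , c , uxs , lxs = tour-to zero
    in long
    (chain-++
      (chain-map (row s false)
        (λ {a} {b} (a≢b , _) → step (λ ()) (row≢core-line v-core) (joined-row s false a≢b) (rows≤ s false a false b)) c)
      (step (λ ()) (row≢core-line v-core) (joined-match s false zero)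
        (ℕ.<⇒≤ (row<core (row s false zero) (core s zero) (_ , refl) (_ , refl))))
      (chain-++
        (chain-map (core s) (λ {a} {b} a≢b → step (λ ()) core≢v (joined-core s a≢b) (cores≤ s a b)) d)
        (step (λ ()) core≢v (joined-apex s z) (core≤apex′ s z s))
        (step-new (subst (_≤ degree v) (sym (degree-apex-suc s₋)) (degree-in-core v v-core)) ∷ [-] {x = v})))
    (unique-map-++ row-injective uxs
      (all-map-++ (λ _ _ ()) ys ((λ _ ()) ∷ (λ _ → row≢core-line v-core) ∷ []))
      (unique-map-++ core-injective uys ((λ _ ()) ∷ (λ _ → core≢v) ∷ []) ((u≢v ∷ []) ∷ [] ∷ [])))
    (trans (length-map-++ (row s false) xs _ lxs)
      (cong (suc p +_) (length-map-++ (core s) ys _ lys) ⟨ trans ⟩ arith p))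
    where
    s : Fin (suc t)
    s = suc s₋
    open Extension (apex s) v u≢v nonadj
    core≢v : ∀ {a} → core s a ≢ v
    core≢v refl = far refl
    arith : ∀ p → suc p + (suc p + 2) ≡ suc (suc p + suc (suc p))
    arith = solve-∀

  extensible-sym : ∀ {u v} → Extensible u v → Extensible v u
  extensible-sym {u} {v} ext v≢u nonadj =
    mpGe-cong (addEdge-comm hub (encode u) (encode v)) (ext (v≢u ∘ sym) (trans (joined-sym u v) nonadj))

  -- At most one of two blocks is block 0, so the path can be started in the other one.
  cores-extensible : ∀ u v → IsCore (line u) → IsCore (line v) → block u ≢ block v → Extensible u v
  cores-extensible (core (suc s) i) v _ v-core far = core-far s i v v-core (far ∘ sym)
  cores-extensible (apex (suc s)) v _ v-core far = apex-far s v v-core (far ∘ sym)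
  cores-extensible u@(core zero _) (core (suc s) j) u-core _ far = extensible-sym (core-far s j u u-core far)
  cores-extensible u@(core zero _) (apex (suc s)) u-core _ far = extensible-sym (apex-far s u u-core far)
  cores-extensible u@(apex zero) (core (suc s) j) u-core _ far = extensible-sym (core-far s j u u-core far)
  cores-extensible u@(apex zero) (apex (suc s)) u-core _ far = extensible-sym (apex-far s u u-core far)
  cores-extensible (core zero _) (core zero _) _ _ far = contradiction refl far
  cores-extensible (core zero _) (apex zero) _ _ far = contradiction refl far
  cores-extensible (apex zero) (core zero _) _ _ far = contradiction refl far
  cores-extensible (apex zero) (apex zero) _ _ far = contradiction refl far

  row-core : ∀ s σ i s′ j → Extensible (row s σ i) (core s′ j)
  row-core s σ i s′ j = by-block (s ≟ s′)
    where
    same-block : ∀ s → Extensible (row s σ i) (core s j)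
    same-block zero = row-near-core-zero σ i j
    same-block (suc s) = row-near-core-suc s σ i j
    by-block : Dec (s ≡ s′) → Extensible (row s σ i) (core s′ j)
    by-block (yes refl) = same-block s
    by-block (no s≢s′) = row-far-core s σ i (core s′ j) (λ _ _ ()) (λ { _ refl → s≢s′ refl })
      (ℕ.≤-trans (ℕ.n≤1+n _) (degree-in-core (core s′ j) (_ , refl)))

  row-apex : ∀ s σ i s′ → Extensible (row s σ i) (apex s′)
  row-apex s σ i s′ = row-far-core s σ i (apex s′) (λ _ _ ()) (λ _ ()) (ℕ.≤-trans (ℕ.n≤1+n _) (core≤apex s′))

  -- Distinct vertices on one line are always adjacent, so a nonadjacent pair lies on two lines;
  -- this yields the hypotheses `other` and `far`.
  extensible : ∀ u v → Extensible u v
  extensible (row s σ i) (row s′ τ j) u≢v nonadj = row-row s σ i s′ τ j other u≢v nonadj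
    where
    other : (s , σ) ≢ (s′ , τ)
    other refl = contradiction (trans (sym nonadj) (joined-row s σ λ { refl → u≢v refl })) λ ()
  extensible (row s σ i) (core s′ j) = row-core s σ i s′ j
  extensible (row s σ i) (apex s′) = row-apex s σ i s′
  extensible (core s i) (row s′ τ j) = extensible-sym (row-core s′ τ j s i)
  extensible (apex s) (row s′ τ j) = extensible-sym (row-apex s′ τ j s)
  extensible u@(core s i) v@(core s′ j) u≢v nonadj = cores-extensible u v (_ , refl) (_ , refl) far u≢v nonadj
    where
    far : s ≢ s′
    far refl = contradiction (trans (sym nonadj) (joined-core s λ { refl → u≢v refl })) λ ()
  extensible u@(core s i) v@(apex s′) u≢v nonadj = cores-extensible u v (_ , refl) (_ , refl) far u≢v nonadj
    where
    far : s ≢ s′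
    far refl = contradiction (trans (sym nonadj) (joined-apex s i)) λ ()
  extensible u@(apex s) v@(core s′ j) u≢v nonadj = cores-extensible u v (_ , refl) (_ , refl) far u≢v nonadj
    where
    far : s ≢ s′
    far refl = contradiction (trans (sym nonadj) (joined-apex s j)) λ ()
  extensible u@(apex s) v@(apex s′) u≢v = cores-extensible u v (_ , refl) (_ , refl) (λ { refl → u≢v refl }) u≢v

  hub-saturated : IsSaturated threshold hub
  hub-saturated = hub-simple , hub-mpLt , λ x y x≢y nonadj →
    subst₂ (λ a b → mpGe (addEdge hub a b) threshold) (encode-decode x) (encode-decode y)
      (extensible (decode x) (decode y) (x≢y ∘ decode-injective) nonadj)

-- The bound in terms of k and n

hub-bound : ∀ t p {k n} → k ≡ Hub.threshold t p → n ≡ suc t * Hub.size t p →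
  Σ (Adj n) λ G → IsSaturated k G × 4 * (3 * k ∸ 4) * edgeCount G ≤ n * (3 * k + 8) * (k ∸ 2)
-- The bound is attained: `3k - 4` is `2 * size`, and doubling `edgeCount` gives the degree sum,
-- after which both sides agree as polynomials.
hub-bound t p refl refl = hub , hub-saturated , ℕ.≤-reflexive (begin
  4 * (3 * threshold ∸ 4) * edgeCount hub
    ≡⟨ cong (λ m → 4 * m * edgeCount hub) (trans (cong (_∸ 4) (3k p)) (ℕ.m+n∸m≡n 4 (2 * size))) ⟩
  4 * (2 * size) * edgeCount hub
    ≡⟨ regroup size (edgeCount hub) ⟩
  4 * size * (2 * edgeCount hub)
    ≡⟨ cong (4 * size *_) edgeCount-hub ⟩
  4 * size * (suc t * (suc p * (10 + 3 * p)))
    ≡⟨ expand size (suc t) p ⟩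
  suc t * size * (3 * threshold + 8) * (threshold ∸ 2) ∎)
  where
  open ≡-Reasoning
  open Hub t p
  3k : ∀ p → 3 * suc (suc p + suc (suc p)) ≡ 4 + 2 * suc (suc p + (suc p + suc p))
  3k = solve-∀
  regroup : ∀ a e → 4 * (2 * a) * e ≡ 4 * a * (2 * e)
  regroup = solve-∀
  expand : ∀ a b p → 4 * a * (b * (suc p * (10 + 3 * p))) ≡ b * a * (3 * suc (suc p + suc (suc p)) + 8) * (p + suc (suc p))
  expand = solve-∀

theorem2p7 : (k : ℕ) → 4 ≤ k → 2 ∣ k → (n : ℕ) → 1 ≤ n → ((3 * k ∸ 4) / 2) ∣ n →
    Σ (Adj n) λ G → IsSaturated k G × 4 * (3 * k ∸ 4) * edgeCount G ≤ n * (3 * k + 8) * (k ∸ 2)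
theorem2p7 k (s≤s (s≤s ())) (divides 1 refl)
-- The quotients supply the parameters: `k / 2` is `p + 2`, and `n` consists of `t + 1` blocks.
theorem2p7 k 4≤k (divides (suc (suc p)) refl) n 1≤n (divides (suc t) n≡) =
  hub-bound t p (half p) (trans n≡ (cong (suc t *_) (trans (cong (_/ 2) size-eq) (m*n/n≡m (Hub.size t p) 2))))
  where
  half : ∀ p → suc (suc p) * 2 ≡ suc (suc p + suc (suc p))
  half = solve-∀
  triple : ∀ p → 3 * (suc (suc p) * 2) ≡ 4 + suc (suc p + (suc p + suc p)) * 2
  triple = solve-∀
  size-eq : 3 * (suc (suc p) * 2) ∸ 4 ≡ Hub.size t p * 2
  size-eq = trans (cong (_∸ 4) (triple p)) (ℕ.m+n∸m≡n 4 _)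
theorem2p7 k 4≤k (divides (suc (suc p)) refl) n () (divides zero refl)
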